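{- For every integer $n\geq 2$ and every permutation $\mathbf{a}$ of $[n]=\{1,\dots,n\}$, $\mathbf{a}$ contains a pair of twins of length at least $\tfrac{1}{8}n^{3/5}$.
   Context: A permutation of a finite set $\Sigma\subset\mathbb{N}$ is a sequence in which every element of $\Sigma$ appears exactly once; a subpermutation of a permutation is a subsequence of it. Two sequences $(a_1,\dots,a_L)$ and $(b_1,\dots,b_L)$ of distinct numbers are order-isomorphic if for all $i,j$: $a_i<a_j \iff b_i<b_j$. Two subpermutations of a permutation are called twins if they are order-isomorphic and disjoint (share no symbol); their length is their common number of entries. -}

module Defs where

open import Data.List using (List)
open import Data.List.Membership.Propositional using (_∈_)
open import Data.List.Relation.Binary.Disjoint.Propositional using (Disjoint)
open import Data.List.Relation.Binary.Sublist.Propositional using (_⊆_)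
open import Data.List.Relation.Unary.Unique.Propositional using (Unique)
open import Data.Nat using (ℕ; _≤_; _<_)
open import Data.Product using (_×_)
open import Data.Vec using (Vec; lookup; toList)
open import Function using (_⇔_)
open import Level using (0ℓ)
open import Relation.Unary using (Pred)

[1⋯_] : ℕ → Pred ℕ 0ℓ
[1⋯ n ] x = 1 ≤ x × x ≤ n

-- Finiteness of S is not assumed separately: S is enumerated by the list a.
IsPermutationOf : Pred ℕ 0ℓ → List ℕ → Set
IsPermutationOf S a = Unique a × (∀ x → x ∈ a ⇔ S x)

OrderIsomorphic : ∀ {L} → Vec ℕ L → Vec ℕ L → Set
OrderIsomorphic u v = ∀ i j → (lookup u i < lookup u j) ⇔ (lookup v i < lookup v j)

-- The stdlib relation _⊆_ used here is the (order-preserving) subsequence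
-- relation on lists, not inclusion of underlying sets.
record Twins (a : List ℕ) {L} (u v : Vec ℕ L) : Set where
  field
    subpermutationˡ : toList u ⊆ a
    subpermutationʳ : toList v ⊆ a
    orderIsomorphic : OrderIsomorphic u v
    disjoint        : Disjoint (toList u) (toList v)

{-# OPTIONS --safe #-}

-- Cut the permutation into P blocks of m consecutive positions and the values into V bands of h
-- consecutive values.  Inside the top band, chop what remains of each block into triples of consecutive
-- entries.  As in Beame–Huynh-Ngoc, any two triples agree on the order of two of the three pairs of
-- coordinates, so from k triples one gets at least k^(1/3) pairs, all ordered the same way, each inside
-- one block.  Discard the blocks used by these pairs and go on with the next lower band: pairs from
-- different bands then lie in different blocks and in separated value ranges, hence are compatible, and
-- all the pairs together form twins.  Only the at most L blocks used and at most 2 entries per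
-- (unused block, band) are lost, so with q ≈ n^(1/5), h = 3q³, m = 3q² and V ≈ q²/2 the total length L
-- is at least n^(3/5)/8 once q ≥ 12.  For n < 12⁵ a monotone subsequence (Erdős–Szekeres), cut into
-- consecutive pairs, is long enough.

module Submission where

open import Data.Fin using (Fin; zero; suc)
open import Data.List using (List; []; _∷_; _++_; length; map; concat; concatMap; tabulate; filter; take; drop; applyUpTo)
open import Data.List.Membership.Propositional using (_∈_; find)
open import Data.List.Membership.Propositional.Properties using (∈-∃++; ∈-++⁺ˡ; ∈-++⁺ʳ; ∈-++⁻; ∈-applyUpTo⁺; ∈-applyUpTo⁻)
open import Data.List.Properties
  using (length-++; length-map; length-take; length-drop; length-applyUpTo; concatMap-++; map-++; ++-identityʳ;
         take++drop≡id; ++-conicalˡ; ++-conicalʳ)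
open import Data.List.Relation.Binary.Disjoint.Propositional using (Disjoint)
open import Data.List.Relation.Binary.Permutation.Propositional as ↭
  using (_↭_; refl; prep; swap; ↭-refl; ↭-sym; ↭⇒↭ₛ; module PermutationReasoning)
import Data.List.Relation.Binary.Permutation.Propositional.Properties as ↭
import Data.List.Relation.Binary.Permutation.Setoid.Properties as Permutation
open import Data.List.Relation.Binary.Sublist.Propositional
  using (_⊆_; []; _∷_; _∷ʳ_; ⊆-refl; ⊆-trans; ⊆-reflexive; minimum; lookup)
open import Data.List.Relation.Binary.Sublist.Propositional.Properties using (All-resp-⊆; ++⁺; filter-⊆)
open import Data.List.Relation.Unary.All as All using (All; []; _∷_)
import Data.List.Relation.Unary.All.Properties as All
open import Data.List.Relation.Unary.AllPairs as AllPairs using (AllPairs; []; _∷_)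
import Data.List.Relation.Unary.AllPairs.Properties as AllPairs
open import Data.List.Relation.Unary.Any using (any?; here; there)
open import Data.List.Relation.Unary.Sorted.TotalOrder.Properties using (Sorted⇒AllPairs)
open import Data.List.Relation.Unary.Unique.Propositional using (Unique)
import Data.List.Relation.Unary.Unique.Propositional.Properties as Unique
import Data.List.Sort as Sort
open import Data.Nat hiding (compare)
open import Data.Nat.DivMod using (m/n*n≤m; m≡m%n+[m/n]*n; m%n<n)
open import Data.Nat.Properties
open import Data.Nat.Tactic.RingSolver using (solve-∀)
open import Data.Product using (∃₂; ∃-syntax; Σ-syntax; _×_; _,_; proj₁; proj₂; -,_)
open import Data.Sum using (_⊎_; inj₁; inj₂; [_,_]′)
open import Data.Vec as Vec using (Vec; fromList)
import Data.Vec.Properties as Vec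
open import Algebra.Properties.CommutativeMonoid.Sum +-0-commutativeMonoid using (sum; ∑-distrib-+)
open import Algebra.Properties.CommutativeSemigroup *-commutativeSemigroup using (interchange; x∙yz≈y∙xz)
open import Function using (_∘_; _on_; id; _⇔_; mk⇔; Equivalence)
open import Level using (0ℓ)
open import Relation.Binary using (Rel; Symmetric; Transitive; Decidable; tri<; tri≈; tri>)
import Relation.Binary.Construct.On as On
open import Relation.Binary.PropositionalEquality
  using (_≡_; _≢_; refl; sym; trans; cong; cong₂; subst; subst₂; setoid; resp₂)
open import Relation.Nullary using (yes; no; ¬?; contradiction)
open import Relation.Nullary.Decidable using (toWitness)
open import Relation.Unary using (Pred) renaming (Decidable to Decidable₁)
open import Defs

private variable
  A A′ : Set
  xs ys : List A

-- Sublists, rearrangements and the pigeonhole principle.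

AllPairs-resp-⊆ : {R : Rel A 0ℓ} → xs ⊆ ys → AllPairs R ys → AllPairs R xs
AllPairs-resp-⊆ []        []       = []
AllPairs-resp-⊆ (_ ∷ʳ τ)  (_ ∷ rs) = AllPairs-resp-⊆ τ rs
AllPairs-resp-⊆ (refl ∷ τ) (r ∷ rs) = All-resp-⊆ τ r ∷ AllPairs-resp-⊆ τ rs

AllPairs-resp-↭ : {R : Rel A 0ℓ} → Symmetric R → xs ↭ ys → AllPairs R xs → AllPairs R ys
AllPairs-resp-↭ {R = R} R-sym p = Permutation.AllPairs-resp-↭ (setoid _) R-sym (resp₂ R) (↭⇒↭ₛ p)

-- Triples are compared after sorting by first entry, but the selected ones must appear in their
-- original order. This carries a selection made in the sorted list back to the unsorted one.
⊆-resp-↭ : {zs : List A} → xs ⊆ ys → ys ↭ zs → ∃[ ws ] ws ⊆ zs × xs ↭ ws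
⊆-resp-↭ τ refl = -, τ , refl
⊆-resp-↭ (_ ∷ʳ τ) (prep x p) with ws , σ , q ← ⊆-resp-↭ τ p = ws , x ∷ʳ σ , q
⊆-resp-↭ (refl ∷ τ) (prep x p) with ws , σ , q ← ⊆-resp-↭ τ p = -, refl ∷ σ , prep x q
⊆-resp-↭ (_ ∷ʳ _ ∷ʳ τ) (swap x y p) with ws , σ , q ← ⊆-resp-↭ τ p = ws , y ∷ʳ x ∷ʳ σ , q
⊆-resp-↭ (_ ∷ʳ refl ∷ τ) (swap x y p) with ws , σ , q ← ⊆-resp-↭ τ p = -, refl ∷ x ∷ʳ σ , prep y q
⊆-resp-↭ (refl ∷ _ ∷ʳ τ) (swap x y p) with ws , σ , q ← ⊆-resp-↭ τ p = -, y ∷ʳ refl ∷ σ , prep x q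
⊆-resp-↭ (refl ∷ refl ∷ τ) (swap x y p) with ws , σ , q ← ⊆-resp-↭ τ p = -, refl ∷ refl ∷ σ , swap x y q
⊆-resp-↭ τ (↭.trans p q)
  with ws , σ , r ← ⊆-resp-↭ τ p
  with ws′ , σ′ , r′ ← ⊆-resp-↭ σ q = ws′ , σ′ , ↭.trans r r′

Unique⇒length≤ : Unique xs → (∀ {x} → x ∈ xs → x ∈ ys) → length xs ≤ length ys
Unique⇒length≤ {xs = []} _ _ = z≤n
Unique⇒length≤ {xs = x ∷ xs} (x∉ ∷ u) f with ys₁ , ys₂ , refl ← ∈-∃++ (f (here refl)) = begin
  suc (length xs)                  ≤⟨ s≤s (Unique⇒length≤ u drop-x) ⟩
  suc (length (ys₁ ++ ys₂))        ≡⟨ cong suc (length-++ ys₁) ⟩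
  suc (length ys₁ + length ys₂)    ≡⟨ +-suc (length ys₁) (length ys₂) ⟨
  length ys₁ + suc (length ys₂)    ≡⟨ length-++ ys₁ ⟨
  length (ys₁ ++ x ∷ ys₂)          ∎
  where
  open ≤-Reasoning
  drop-x : ∀ {y} → y ∈ xs → y ∈ ys₁ ++ ys₂
  drop-x y∈ with ∈-++⁻ ys₁ (f (there y∈))
  ... | inj₁ y∈₁          = ∈-++⁺ˡ y∈₁
  ... | inj₂ (here y≡x)   = contradiction (sym y≡x) (All.lookup x∉ y∈)
  ... | inj₂ (there y∈₂)  = ∈-++⁺ʳ ys₁ y∈₂

Unique-interval-length : ∀ {xs} l h → Unique xs → All (λ x → l ≤ x × x < l + h) xs → length xs ≤ h
Unique-interval-length {xs} l h u bounds =
  ≤-trans (Unique⇒length≤ u (inside ∘ All.lookup bounds)) (≤-reflexive (length-applyUpTo (l +_) h))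
  where
  inside : ∀ {x} → l ≤ x × x < l + h → x ∈ applyUpTo (l +_) h
  inside {x} (l≤x , x<l+h) = subst (_∈ applyUpTo (l +_) h) (m+[n∸m]≡n l≤x)
    (∈-applyUpTo⁺ (l +_) (+-cancelˡ-< l _ _ (subst (_< l + h) (sym (m+[n∸m]≡n l≤x)) x<l+h)))

-- Mirsky's theorem: long chains for one of two relations.

-- x goes to the first class with no R-successor of x, so each class is an S-chain; a member of class j
-- has an R-successor in class j - 1, whence R-chains as long as the number of classes.
module Mirsky {R S : Rel A 0ℓ} (R? : Decidable R) (R-trans : Transitive R) where

  Height : List A → ℕ → A → Set
  Height xs j y = ∃[ C ] (y ∷ C ⊆ xs) × AllPairs R (y ∷ C) × length C ≡ j

  data Levels (xs : List A) (j : ℕ) : ℕ → Set where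
    []  : Levels xs j 0
    cons : ∀ {y D n} → y ∷ D ⊆ xs → AllPairs S (y ∷ D) → All (Height xs j) (y ∷ D) →
           Levels xs (suc j) n → Levels xs j (length (y ∷ D) + n)

  weaken-height : ∀ {x xs j y} → Height xs j y → Height (x ∷ xs) j y
  weaken-height (C , τ , rest) = C , _ ∷ʳ τ , rest

  weaken : ∀ {x xs j n} → Levels xs j n → Levels (x ∷ xs) j n
  weaken [] = []
  weaken (cons τ s hs ls) = cons (_ ∷ʳ τ) s (All.map weaken-height hs) (weaken ls)

  insert : ∀ {x xs j n} → All (λ y → R x y ⊎ S x y) xs → Height (x ∷ xs) j x →
           Levels xs j n → Levels (x ∷ xs) j (suc n)
  insert _ h [] = cons (refl ∷ minimum _) ([] ∷ []) (h ∷ []) []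
  insert {x} rs h (cons {y} {D} {n} τ s hs ls) with any? (R? x) (y ∷ D)
  ... | no ¬r = cons (refl ∷ τ)
    (All.zipWith (λ (r⊎s , ¬Rx) → [ (λ r → contradiction r ¬Rx) , id ]′ r⊎s) (All-resp-⊆ τ rs , All.¬Any⇒All¬ _ ¬r) ∷ s)
    (h ∷ All.map weaken-height hs) (weaken ls)
  ... | yes r with z , z∈D , Rxz ← find r
              with C , σ , Rz ∷ RC , |C| ← All.lookup hs z∈D =
    subst (Levels _ _) (+-suc (length (y ∷ D)) n)
      (cons (_ ∷ʳ τ) s (All.map weaken-height hs)
        (insert rs (-, refl ∷ σ , (Rxz ∷ All.map (R-trans Rxz) Rz) ∷ Rz ∷ RC , cong suc |C|) ls))

  levels : ∀ {xs} → AllPairs (λ x y → R x y ⊎ S x y) xs → Levels xs 0 (length xs)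
  levels []       = []
  levels (r ∷ rs) = insert r ([] , refl ∷ minimum _ , [] ∷ [] , refl) (levels rs)

  -- `C₀` is the chain behind a member of the preceding class, so starting from `j = 0` it has one
  -- entry per class once the classes run out. `D` is the longest class met, and the number of
  -- classes times its length bounds the number of entries.
  extract : ∀ {xs j n C₀} → C₀ ⊆ xs → AllPairs R C₀ → length C₀ ≡ j → Levels xs j n →
            ∃₂ λ C D → ∃[ k ] C ⊆ xs × AllPairs R C × D ⊆ xs × AllPairs S D ×
                       length C ≡ j + k × n ≤ k * length D
  extract {j = j} τ r eq [] = -, [] , 0 , τ , r , minimum _ , [] , trans eq (sym (+-identityʳ j)) , z≤n
  extract {j = j} _ _ _ (cons {y} {D} {n} τ s ((C₁ , τ₁ , r₁ , eq₁) ∷ _) ls)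
    with C , E , k , σ , r , τE , sE , eq , n≤ ← extract τ₁ r₁ (cong suc eq₁) ls
    with ≤-total (length (y ∷ D)) (length E)
  ... | inj₁ d≤e = C , E , suc k , σ , r , τE , sE , trans eq (sym (+-suc j k)) , +-mono-≤ d≤e n≤
  ... | inj₂ e≤d = C , y ∷ D , suc k , σ , r , τ , s , trans eq (sym (+-suc j k)) ,
                   +-monoʳ-≤ (length (y ∷ D)) (≤-trans n≤ (*-monoʳ-≤ k e≤d))

  mirsky : ∀ {xs} → AllPairs (λ x y → R x y ⊎ S x y) xs →
           ∃₂ λ C D → C ⊆ xs × AllPairs R C × D ⊆ xs × AllPairs S D × length xs ≤ length C * length D
  mirsky rs with C , D , k , τ , r , σ , s , eq , n≤ ← extract (minimum _) [] refl (levels rs) =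
    C , D , τ , r , σ , s , subst (λ l → _ ≤ l * length D) (sym eq) n≤

open Mirsky using (mirsky)

-- Pairs and triples of entries, and their order patterns.

Pair Triple : Set
Pair = ℕ × ℕ
Triple = ℕ × ℕ × ℕ

-- A pair will be a column of the twins: first coordinates form one twin, second coordinates the
-- other. This is what order-isomorphism demands of two different columns.
Same : Rel Pair 0ℓ
Same (x , y) (x′ , y′) = (x < x′ × y < y′) ⊎ (x′ < x × y′ < y)

Same-sym : Symmetric Same
Same-sym (inj₁ p) = inj₂ p
Same-sym (inj₂ p) = inj₁ p

flat : List Pair → List ℕ
flat = concatMap λ (x , y) → x ∷ y ∷ []

flat³ : List Triple → List ℕ
flat³ = concatMap λ (x , y , z) → x ∷ y ∷ z ∷ []

data Selector : Set where
  ₁₂ ₁₃ ₂₃ : Selector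

select : Selector → Triple → Pair
select ₁₂ (x , y , z) = x , y
select ₁₃ (x , y , z) = x , z
select ₂₃ (x , y , z) = y , z

flat-select : ∀ σ T → flat (map (select σ) T) ⊆ flat³ T
flat-select σ  [] = []
flat-select ₁₂ (t ∷ T) = refl ∷ refl ∷ _ ∷ʳ flat-select ₁₂ T
flat-select ₁₃ (t ∷ T) = refl ∷ _ ∷ʳ refl ∷ flat-select ₁₃ T
flat-select ₂₃ (t ∷ T) = _ ∷ʳ refl ∷ refl ∷ flat-select ₂₃ T

Distinct : Rel Triple 0ℓ
Distinct (x , y , z) (x′ , y′ , z′) = x ≢ x′ × y ≢ y′ × z ≢ z′

Distinct-sym : Symmetric Distinct
Distinct-sym (p , q , r) = p ∘ sym , q ∘ sym , r ∘ sym

flat³-distinct : ∀ T → Unique (flat³ T) → AllPairs Distinct T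
flat³-distinct [] _ = []
flat³-distinct ((x , y , z) ∷ T) ((_ ∷ _ ∷ x∉) ∷ (_ ∷ y∉) ∷ z∉ ∷ u) = head T x∉ y∉ z∉ ∷ flat³-distinct T u
  where
  head : ∀ T → All (x ≢_) (flat³ T) → All (y ≢_) (flat³ T) → All (z ≢_) (flat³ T) →
         All (Distinct (x , y , z)) T
  head [] _ _ _ = []
  head (t ∷ T) (p ∷ _ ∷ _ ∷ ps) (_ ∷ q ∷ _ ∷ qs) (_ ∷ _ ∷ r ∷ rs) = (p , q , r) ∷ head T ps qs rs

-- For two triples sorted by first entry, failing to agree on (1,2) and on (1,3) means that both other
-- comparisons are reversed, so the triples agree on (2,3).
same-sublist : ∀ T → Unique (flat³ T) →
               ∃₂ λ σ S → S ⊆ T × AllPairs (Same on select σ) S × length T ≤ length S ^ 3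
same-sublist T u = from-sorted
  where
  order = On.decTotalOrder ≤-decTotalOrder (proj₁ {A = ℕ} {B = λ _ → ℕ × ℕ})
  open Sort order using (sort; sort-↭; sort-↗)

  _<₁_ _<₂_ _<₃_ : Rel Triple 0ℓ
  (x , _ , _) <₁ (x′ , _ , _) = x < x′
  (_ , y , _) <₂ (_ , y′ , _) = y < y′
  (_ , _ , z) <₃ (_ , _ , z′) = z < z′

  increasing : AllPairs _<₁_ (sort T)
  increasing = AllPairs.zipWith (λ (x≤x′ , x≢x′ , _) → ≤∧≢⇒< x≤x′ x≢x′)
    (Sorted⇒AllPairs (On.totalOrder ≤-totalOrder proj₁) (sort-↗ T) , distinct)
    where distinct = AllPairs-resp-↭ Distinct-sym (↭-sym (sort-↭ T)) (flat³-distinct T u)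

  <₂-or-<₃-or-> : AllPairs (λ t t′ → t <₂ t′ ⊎ t <₃ t′ ⊎ (t′ <₂ t × t′ <₃ t)) (sort T)
  <₂-or-<₃-or-> = AllPairs.map compare
    (AllPairs-resp-↭ Distinct-sym (↭-sym (sort-↭ T)) (flat³-distinct T u))
    where
    compare : ∀ {t t′} → Distinct t t′ → t <₂ t′ ⊎ t <₃ t′ ⊎ (t′ <₂ t × t′ <₃ t)
    compare {_ , y , z} {_ , y′ , z′} (_ , y≢ , z≢) with <-cmp y y′ | <-cmp z z′
    ... | tri< y< _ _ | _ = inj₁ y<
    ... | tri≈ _ y≡ _ | _ = contradiction y≡ y≢
    ... | tri> _ _ _  | tri< z< _ _ = inj₂ (inj₁ z<)
    ... | tri> _ _ _  | tri≈ _ z≡ _ = contradiction z≡ z≢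
    ... | tri> _ _ y> | tri> _ _ z> = inj₂ (inj₂ (y> , z>))

  unsort : ∀ σ {S k} → S ⊆ sort T → AllPairs (Same on select σ) S → k ≡ length S →
           ∃[ S′ ] S′ ⊆ T × AllPairs (Same on select σ) S′ × length S′ ≡ k
  unsort σ τ same refl with S′ , τ′ , p ← ⊆-resp-↭ τ (sort-↭ T) =
    S′ , τ′ , AllPairs-resp-↭ Same-sym p same , sym (↭.↭-length p)

  module _ {S₁ S₂ S₃} (τ₁ : S₁ ⊆ sort T) (τ₂ : S₂ ⊆ sort T) (τ₃ : S₃ ⊆ sort T)
           (c₁ : AllPairs _<₂_ S₁) (c₂ : AllPairs _<₃_ S₂)
           (c₃ : AllPairs (λ t t′ → t′ <₂ t × t′ <₃ t) S₃)
           (bound : length (sort T) ≤ length S₁ * (length S₂ * length S₃)) where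

    pick : ∀ σ {S} → S ⊆ sort T → AllPairs (Same on select σ) S →
           length S₁ ≤ length S → length S₂ ≤ length S → length S₃ ≤ length S →
           ∃₂ λ σ S → S ⊆ T × AllPairs (Same on select σ) S × length T ≤ length S ^ 3
    pick σ {S} τ same le₁ le₂ le₃ with S′ , τ′ , same′ , eq ← unsort σ τ same refl =
      σ , S′ , τ′ , same′ , (begin
        length T                            ≡⟨ ↭.↭-length (sort-↭ T) ⟨
        length (sort T)                     ≤⟨ bound ⟩
        length S₁ * (length S₂ * length S₃) ≤⟨ *-mono-≤ le₁ (*-mono-≤ le₂ (≤-trans le₃ (≤-reflexive (sym (*-identityʳ _))))) ⟩
        length S ^ 3                        ≡⟨ cong (_^ 3) eq ⟨
        length S′ ^ 3                       ∎)
      where open ≤-Reasoning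

    largest : ∃₂ λ σ S → S ⊆ T × AllPairs (Same on select σ) S × length T ≤ length S ^ 3
    largest with ≤-total (length S₁) (length S₂)
               | ≤-total (length S₁) (length S₃)
               | ≤-total (length S₂) (length S₃)
    ... | inj₂ b≤a | inj₂ c≤a | _ = pick ₁₂ τ₁ (AllPairs.zipWith inj₁ (AllPairs-resp-⊆ τ₁ increasing , c₁)) ≤-refl b≤a c≤a
    ... | inj₁ a≤b | _ | inj₂ c≤b = pick ₁₃ τ₂ (AllPairs.zipWith inj₁ (AllPairs-resp-⊆ τ₂ increasing , c₂)) a≤b ≤-refl c≤b
    ... | inj₁ a≤b | _ | inj₁ b≤c = pick ₂₃ τ₃ (AllPairs.map inj₂ c₃) (≤-trans a≤b b≤c) b≤c ≤-refl
    ... | inj₂ b≤a | inj₁ a≤c | _ = pick ₂₃ τ₃ (AllPairs.map inj₂ c₃) a≤c (≤-trans b≤a a≤c) ≤-refl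

  from-sorted : ∃₂ λ σ S → S ⊆ T × AllPairs (Same on select σ) S × length T ≤ length S ^ 3
  from-sorted
    -- The first application splits off triples increasing in the second entry; the second splits
    -- the leftover `D` by the third entry. The three lengths multiply to at least the number of
    -- triples, so the largest is at least its cube root.
    with S₁ , D , τ₁ , c₁ , τ , d , bound₁ ← mirsky (λ (_ , y , _) (_ , y′ , _) → y <? y′) <-trans <₂-or-<₃-or->
    with S₂ , S₃ , τ₂ , c₂ , τ₃ , c₃ , bound₂ ← mirsky (λ (_ , _ , z) (_ , _ , z′) → z <? z′) <-trans d =
    largest τ₁ (⊆-trans τ₂ τ) (⊆-trans τ₃ τ) c₁ c₂ c₃ (≤-trans bound₁ (*-monoʳ-≤ (length S₁) bound₂))

-- From compatible pairs to twins.

map-proj₁-⊆-flat : ∀ W → map proj₁ W ⊆ flat W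
map-proj₁-⊆-flat []      = []
map-proj₁-⊆-flat (_ ∷ W) = refl ∷ _ ∷ʳ map-proj₁-⊆-flat W

map-proj₂-⊆-flat : ∀ W → map proj₂ W ⊆ flat W
map-proj₂-⊆-flat []      = []
map-proj₂-⊆-flat (_ ∷ W) = _ ∷ʳ refl ∷ map-proj₂-⊆-flat W

flat-disjoint : ∀ W → Unique (flat W) → Disjoint (map proj₁ W) (map proj₂ W)
flat-disjoint (_ ∷ W) ((x≢y ∷ _) ∷ _) (here refl , here refl)  = x≢y refl
flat-disjoint (_ ∷ W) ((_ ∷ x∉) ∷ _)  (here refl , there x∈)   = All.lookup x∉ (lookup (map-proj₂-⊆-flat W) x∈) refl
flat-disjoint (_ ∷ W) (_ ∷ y∉ ∷ _)    (there y∈  , here refl)  = All.lookup y∉ (lookup (map-proj₁-⊆-flat W) y∈) refl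
flat-disjoint (_ ∷ W) (_ ∷ _ ∷ u)     (there v∈  , there v∈′)  = flat-disjoint W u (v∈ , v∈′)

-- `Same` is irreflexive, so the diagonal needs a disjunct of its own; positions in descending order
-- follow by symmetry.
Same-lookup : ∀ {W} → AllPairs Same W → ∀ i j →
              i ≡ j ⊎ Same (Vec.lookup (fromList W) i) (Vec.lookup (fromList W) j)
Same-lookup (_ ∷ _)  zero    zero    = inj₁ refl
Same-lookup (s ∷ _)  zero    (suc j) = inj₂ (head s j)
  where
  head : ∀ {P : Pred A 0ℓ} {xs} → All P xs → ∀ i → P (Vec.lookup (fromList xs) i)
  head (p ∷ _)  zero    = p
  head (_ ∷ ps) (suc i) = head ps i
Same-lookup {W = _ ∷ W} (s ∷ ss) (suc i) zero = [ (λ ()) , inj₂ ∘ Same-sym ]′ (Same-lookup {W = _ ∷ W} (s ∷ ss) zero (suc i))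
Same-lookup (_ ∷ ss) (suc i) (suc j) = [ inj₁ ∘ cong suc , inj₂ ]′ (Same-lookup ss i j)

Same⇒⇔ : ∀ {p q} → p ≡ q ⊎ Same p q → (proj₁ p < proj₁ q) ⇔ (proj₂ p < proj₂ q)
Same⇒⇔ (inj₁ refl)             = mk⇔ (λ x< → contradiction refl (<⇒≢ x<)) (λ y< → contradiction refl (<⇒≢ y<))
Same⇒⇔ (inj₂ (inj₁ (x< , y<))) = mk⇔ (λ _ → y<) (λ _ → x<)
Same⇒⇔ (inj₂ (inj₂ (x> , y>))) = mk⇔ (λ x< → contradiction x< (<⇒≯ x>)) (λ y< → contradiction y< (<⇒≯ y>))

-- In `flat W` each pair is complete before the next one begins, so both coordinate lists inherit
-- the order of positions in `a`.
pairs⇒twins : ∀ {a} → Unique a → ∀ W → flat W ⊆ a → AllPairs Same W →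
              Twins a (Vec.map proj₁ (fromList W)) (Vec.map proj₂ (fromList W))
pairs⇒twins u W τ same = record
  { subpermutationˡ = subst (_⊆ _) (toList-map proj₁) (⊆-trans (map-proj₁-⊆-flat W) τ)
  ; subpermutationʳ = subst (_⊆ _) (toList-map proj₂) (⊆-trans (map-proj₂-⊆-flat W) τ)
  ; orderIsomorphic = λ i j →
      subst₂ _⇔_ (cong₂ _<_ (lookup-map i proj₁) (lookup-map j proj₁))
                 (cong₂ _<_ (lookup-map i proj₂) (lookup-map j proj₂))
                 (Same⇒⇔ ([ inj₁ ∘ cong (Vec.lookup (fromList W)) , inj₂ ]′ (Same-lookup same i j)))
  ; disjoint = subst₂ Disjoint (toList-map proj₁) (toList-map proj₂) (flat-disjoint W (AllPairs-resp-⊆ τ u))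
  }
  where
  toList-map : ∀ (f : Pair → ℕ) → map f W ≡ Vec.toList (Vec.map f (fromList W))
  toList-map f = sym (trans (Vec.toList-map f (fromList W)) (cong (map f) (Vec.toList∘fromList W)))
  lookup-map : ∀ i (f : Pair → ℕ) → f (Vec.lookup (fromList W) i) ≡ Vec.lookup (Vec.map f (fromList W)) i
  lookup-map i f = sym (Vec.lookup-map i f (fromList W))

-- Lists divided into a family of blocks.

join : ∀ {n} → (Fin n → List A) → List A
join f = concat (tabulate f)

length-join : ∀ {n} (f : Fin n → List A) → length (join f) ≡ sum (length ∘ f)
length-join {n = zero}  f = refl
length-join {n = suc n} f = trans (length-++ (f zero)) (cong (length (f zero) +_) (length-join (f ∘ suc)))

map-join : ∀ {n} (g : A → A′) (f : Fin n → List A) → map g (join f) ≡ join (map g ∘ f)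
map-join {n = zero}  g f = refl
map-join {n = suc n} g f = trans (map-++ g (f zero) _) (cong (map g (f zero) ++_) (map-join g (f ∘ suc)))

concatMap-join : ∀ {n} (g : A → List A′) (f : Fin n → List A) → concatMap g (join f) ≡ join (concatMap g ∘ f)
concatMap-join {n = zero}  g f = refl
concatMap-join {n = suc n} g f =
  trans (concatMap-++ g (f zero) _) (cong (concatMap g (f zero) ++_) (concatMap-join g (f ∘ suc)))

join-⊆ : ∀ {n} {f g : Fin n → List A} → (∀ i → f i ⊆ g i) → join f ⊆ join g
join-⊆ {n = zero}  τ = []
join-⊆ {n = suc n} τ = ++⁺ (τ zero) (join-⊆ (τ ∘ suc))

join-All : ∀ {n} {P : Pred A 0ℓ} {f : Fin n → List A} → (∀ i → All P (f i)) → All P (join f)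
join-All ps = All.concat⁺ (All.tabulate⁺ ps)

-- Merging blockwise interleaves the two families, hence only a rearrangement. This suffices for
-- lengths and for symmetric relations such as `Same`.
join-++ : ∀ {n} (f g : Fin n → List A) → join (λ i → f i ++ g i) ↭ join f ++ join g
join-++ {n = zero}  f g = ↭-refl
join-++ {n = suc n} f g = begin
  (f₀ ++ g₀) ++ join (λ i → f (suc i) ++ g (suc i)) ↭⟨ ↭.++⁺ˡ (f₀ ++ g₀) (join-++ (f ∘ suc) (g ∘ suc)) ⟩
  (f₀ ++ g₀) ++ f₊ ++ g₊                            ↭⟨ ↭.++-assoc f₀ g₀ _ ⟩
  f₀ ++ g₀ ++ f₊ ++ g₊                              ↭⟨ ↭.++⁺ˡ f₀ (↭.shifts g₀ f₊) ⟩
  f₀ ++ f₊ ++ g₀ ++ g₊                              ↭⟨ ↭.++-assoc f₀ f₊ _ ⟨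
  (f₀ ++ f₊) ++ g₀ ++ g₊                            ∎
  where
  open PermutationReasoning
  f₀ = f zero
  g₀ = g zero
  f₊ = join (f ∘ suc)
  g₊ = join (g ∘ suc)

split-++ : ∀ {ws} (xs : List A) → ws ⊆ xs ++ ys → ∃₂ λ us vs → us ⊆ xs × vs ⊆ ys × ws ≡ us ++ vs
split-++ []       τ = -, -, [] , τ , refl
split-++ (x ∷ xs) (_ ∷ʳ τ) with us , vs , σ , ρ , eq ← split-++ xs τ = us , vs , _ ∷ʳ σ , ρ , eq
split-++ (x ∷ xs) (refl ∷ τ) with us , vs , σ , ρ , refl ← split-++ xs τ = x ∷ us , vs , refl ∷ σ , ρ , refl

-- Returns the triples selected from all blocks at once to the blocks they came from.
split-join : ∀ {n ws} (f : Fin n → List A) → ws ⊆ join f →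
             ∃[ g ] (∀ i → g i ⊆ f i) × ws ≡ join g
split-join {n = zero}  f [] = (λ ()) , (λ ()) , refl
split-join {n = suc n} f τ
  with us , vs , σ , ρ , refl ← split-++ (f zero) τ
  with g , σs , refl ← split-join (f ∘ suc) ρ =
  (λ { zero → us ; (suc i) → g i }) , (λ { zero → σ ; (suc i) → σs i }) , refl

length-filter-¬ : {P : Pred A 0ℓ} (P? : Decidable₁ P) (xs : List A) →
                  length xs ≡ length (filter P? xs) + length (filter (¬? ∘ P?) xs)
length-filter-¬ P? [] = refl
length-filter-¬ P? (x ∷ xs) with P? x
... | yes _ = cong suc (length-filter-¬ P? xs)
... | no  _ = trans (cong suc (length-filter-¬ P? xs)) (sym (+-suc (length (filter P? xs)) _))

All-flat : ∀ {P : Pred ℕ 0ℓ} W → All P (flat W) → All (λ (x , y) → P x × P y) W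
All-flat []      []            = []
All-flat (_ ∷ W) (px ∷ py ∷ ps) = (px , py) ∷ All-flat W ps

length-flat³ : ∀ T → length (flat³ T) ≡ 3 * length T
length-flat³ []      = refl
length-flat³ (_ ∷ T) = trans (cong (3 +_) (length-flat³ T)) (sym (*-suc 3 (length T)))

-- Chopping into triples and discarding used blocks.

chunk : List ℕ → List Triple
chunk (x ∷ y ∷ z ∷ xs) = (x , y , z) ∷ chunk xs
chunk _                = []

flat³-chunk : ∀ xs → flat³ (chunk xs) ⊆ xs
flat³-chunk (x ∷ y ∷ z ∷ xs) = refl ∷ refl ∷ refl ∷ flat³-chunk xs
flat³-chunk []               = []
flat³-chunk (_ ∷ [])         = minimum _
flat³-chunk (_ ∷ _ ∷ [])     = minimum _

length-chunk : ∀ xs → length xs ≤ 3 * length (chunk xs) + 2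
length-chunk (x ∷ y ∷ z ∷ xs) =
  subst (3 + length xs ≤_) (cong (_+ 2) (sym (*-suc 3 (length (chunk xs))))) (+-monoʳ-≤ 3 (length-chunk xs))
length-chunk []               = z≤n
length-chunk (_ ∷ [])         = s≤s z≤n
length-chunk (_ ∷ _ ∷ [])     = ≤-refl

-- A block that has supplied a pair is emptied for the lower bands, so pairs from different bands
-- never interleave in position.
residue : List Pair → List ℕ → List ℕ
residue []      xs = xs
residue (_ ∷ _) _  = []

residue-⊆ : ∀ W xs → residue W xs ⊆ xs
residue-⊆ []      xs = ⊆-refl
residue-⊆ (_ ∷ _) xs = minimum xs

-- At most one of the two lists is non-empty: a pair in `W` empties the residue and so forces `W′`
-- to be empty.
flat-++-residue : ∀ W W′ → flat W ⊆ xs → flat W′ ⊆ residue W ys → ys ⊆ xs → flat (W ++ W′) ⊆ xs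
flat-++-residue []      W′ _ τ σ = ⊆-trans τ σ
flat-++-residue (p ∷ W) [] τ _ _ = subst (λ W → flat (p ∷ W) ⊆ _) (sym (++-identityʳ W)) τ

-- Packing pairs greedily, band by band.

-- `h` is the height of a band and `c` an exchange rate: when `k` triples of a band yield `l` pairs,
-- each pair pays for at most `c` of the `3 * k` entries.
module Bands (h c : ℕ) (gain : ∀ {k l} → k ≤ l ^ 3 → 3 * k ≤ h → 3 * k ≤ c * l) where

  -- K i counts the triples formed in block i while it was still unused.
  record Packing (V : ℕ) {P} (B : Fin P → List ℕ) : Set where
    field
      W       : Fin P → List Pair
      K       : Fin P → ℕ
      flat-⊆  : ∀ i → flat (W i) ⊆ B i
      same    : AllPairs Same (join W)
      yield   : 3 * sum K ≤ c * length (join W)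
      -- A block that never supplied a pair was chopped in every one of the `V` bands, leaving at
      -- most two entries outside the triples each time.
      unused  : ∀ i → W i ≡ [] → length (B i) ≤ 3 * K i + 2 * V

  pack : ∀ V {P} (B : Fin P → List ℕ) → Unique (join B) → (∀ i → All (_< V * h) (B i)) → Packing V B
  pack zero {P} B _ bounded = record
    { W = λ _ → [] ; K = λ _ → 0
    ; flat-⊆ = λ _ → minimum _
    ; same = subst (AllPairs Same) (sym (join-[] P)) []
    ; yield = ≤-trans (≤-reflexive (cong (3 *_) (sum-0 P))) z≤n
    ; unused = λ i _ → empty (bounded i)
    }
    where
    join-[] : ∀ n → join {A = A} {n} (λ _ → []) ≡ []
    join-[] zero    = refl
    join-[] (suc n) = join-[] n
    sum-0 : ∀ n → sum {n} (λ _ → 0) ≡ 0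
    sum-0 zero    = refl
    sum-0 (suc n) = sum-0 n
    empty : ∀ {xs n} → All (_< 0) xs → length xs ≤ n
    empty [] = z≤n
  pack (suc V) {P} B u bounded
    -- The filter keeps the top band, the values from `V * h` on. A single selector serves the
    -- triples of all blocks together.
    with σ , S , τ , same , cube ← same-sublist (join (chunk ∘ λ i → filter (¬? ∘ (_<? V * h)) (B i)))
           (AllPairs-resp-⊆ (⊆-trans (⊆-reflexive (concatMap-join _ (λ i → chunk (filter (¬? ∘ (_<? V * h)) (B i)))))
             (join-⊆ λ i → ⊆-trans (flat³-chunk _) (filter-⊆ _ (B i)))) u)
    with Sᵢ , τᵢ , S≡ ← split-join _ τ = record
    { W = λ i → U i ++ rest.W i
    ; K = λ i → length (T i) + rest.K i
    ; flat-⊆ = λ i → flat-++-residue (U i) (rest.W i)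
        (⊆-trans (flat-U⊆high i) (filter-⊆ _ (B i))) (rest.flat-⊆ i) (filter-⊆ _ (B i))
    -- Across bands, both coordinates of a pair from the top band exceed both coordinates of a lower
    -- pair.
    ; same = AllPairs-resp-↭ Same-sym (↭-sym (join-++ U rest.W)) (AllPairs.++⁺ same-U rest.same
        (All.map (λ (x≮ , y≮) → All.map
          (λ (x′< , y′<) → inj₂ (<-≤-trans x′< (≮⇒≥ x≮) , <-≤-trans y′< (≮⇒≥ y≮))) rest-low) U-high))
    ; yield = yield
    ; unused = λ i eq → unused i (++-conicalˡ (U i) _ eq) (++-conicalʳ (U i) _ eq)
    }
    where
    low high : Fin P → List ℕ
    low  i = filter (_<? V * h) (B i)
    high i = filter (¬? ∘ (_<? V * h)) (B i)

    T : Fin P → List Triple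
    T = chunk ∘ high

    U : Fin P → List Pair
    U i = map (select σ) (Sᵢ i)

    B′ : Fin P → List ℕ
    B′ i = residue (U i) (low i)

    B′⊆low : ∀ i → B′ i ⊆ low i
    B′⊆low i = residue-⊆ (U i) (low i)

    low-bounded : ∀ i → All (_< V * h) (low i)
    low-bounded i = All.all-filter (_<? V * h) (B i)

    module rest = Packing (pack V B′
      (AllPairs-resp-⊆ (join-⊆ λ i → ⊆-trans (B′⊆low i) (filter-⊆ _ (B i))) u)
      (λ i → All-resp-⊆ (B′⊆low i) (low-bounded i)))

    flat³-⊆ : ∀ {S T} → S ⊆ T → flat³ S ⊆ flat³ T
    flat³-⊆ []         = []
    flat³-⊆ (_ ∷ʳ τ)   = _ ∷ʳ _ ∷ʳ _ ∷ʳ flat³-⊆ τ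
    flat³-⊆ (refl ∷ τ) = refl ∷ refl ∷ refl ∷ flat³-⊆ τ

    flat-U⊆high : ∀ i → flat (U i) ⊆ high i
    flat-U⊆high i = ⊆-trans (flat-select σ (Sᵢ i)) (⊆-trans (flat³-⊆ (τᵢ i)) (flat³-chunk (high i)))

    join-U : map (select σ) S ≡ join U
    join-U = trans (cong (map (select σ)) S≡) (map-join (select σ) Sᵢ)

    same-U : AllPairs Same (join U)
    same-U = subst (AllPairs Same) join-U (AllPairs.map⁺ same)

    U-high : All (λ (x , y) → x ≮ V * h × y ≮ V * h) (join U)
    U-high = join-All λ i → All-flat (U i)
      (All-resp-⊆ (flat-U⊆high i) (All.all-filter (¬? ∘ (_<? V * h)) (B i)))

    rest-low : All (λ (x , y) → x < V * h × y < V * h) (join rest.W)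
    rest-low = join-All λ i → All-flat (rest.W i)
      (All-resp-⊆ (⊆-trans (rest.flat-⊆ i) (B′⊆low i)) (low-bounded i))

    flat³T⊆high : flat³ (join T) ⊆ join high
    flat³T⊆high = ⊆-trans (⊆-reflexive (concatMap-join _ T)) (join-⊆ λ i → flat³-chunk (high i))

    high-bounds : All (λ x → V * h ≤ x × x < V * h + h) (join high)
    high-bounds = join-All λ i → All.zip
      ( All.map ≮⇒≥ (All.all-filter (¬? ∘ (_<? V * h)) (B i))
      , All-resp-⊆ (filter-⊆ _ (B i)) (All.map (λ x< → <-≤-trans x< (≤-reflexive (+-comm h (V * h)))) (bounded i)))

    -- The entries of the triples are distinct values inside one band of height `h`.
    3|T|≤h : 3 * length (join T) ≤ h
    3|T|≤h = subst (_≤ h) (length-flat³ (join T)) (Unique-interval-length (V * h) h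
      (AllPairs-resp-⊆ (⊆-trans flat³T⊆high (join-⊆ λ i → filter-⊆ _ (B i))) u)
      (All-resp-⊆ flat³T⊆high high-bounds))

    |U| : length S ≡ length (join U)
    |U| = trans (sym (length-map (select σ) S)) (cong length join-U)

    yield : 3 * sum (λ i → length (T i) + rest.K i) ≤ c * length (join (λ i → U i ++ rest.W i))
    yield = begin
      3 * sum (λ i → length (T i) + rest.K i)           ≡⟨ cong (3 *_) (∑-distrib-+ (length ∘ T) rest.K) ⟩
      3 * (sum (length ∘ T) + sum rest.K)               ≡⟨ *-distribˡ-+ 3 (sum (length ∘ T)) _ ⟩
      3 * sum (length ∘ T) + 3 * sum rest.K             ≡⟨ cong (λ t → 3 * t + 3 * sum rest.K) (length-join T) ⟨
      3 * length (join T) + 3 * sum rest.K              ≤⟨ +-mono-≤ (gain cube 3|T|≤h) rest.yield ⟩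
      c * length S + c * length (join rest.W)   ≡⟨ *-distribˡ-+ c (length S) _ ⟨
      c * (length S + length (join rest.W))     ≡⟨ cong (λ l → c * (l + length (join rest.W))) |U| ⟩
      c * (length (join U) + length (join rest.W))      ≡⟨ cong (c *_) (length-++ (join U)) ⟨
      c * length (join U ++ join rest.W)                ≡⟨ cong (c *_) (↭.↭-length (join-++ U rest.W)) ⟨
      c * length (join (λ i → U i ++ rest.W i))         ∎
      where open ≤-Reasoning

    unused : ∀ i → U i ≡ [] → rest.W i ≡ [] → length (B i) ≤ 3 * (length (T i) + rest.K i) + 2 * suc V
    unused i Uᵢ≡[] Wᵢ≡[] = begin
      length (B i)                                          ≡⟨ length-filter-¬ (_<? V * h) (B i) ⟩
      length (low i) + length (high i)                      ≤⟨ +-mono-≤ low≤ (length-chunk (high i)) ⟩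
      (3 * rest.K i + 2 * V) + (3 * length (T i) + 2)       ≡⟨ regroup (rest.K i) V (length (T i)) ⟩
      3 * (length (T i) + rest.K i) + 2 * suc V             ∎
      where
      open ≤-Reasoning
      low≤ : length (low i) ≤ 3 * rest.K i + 2 * V
      -- `Uᵢ≡[]` makes the residue all of `low i`, so the bound for the lower bands covers the whole
      -- low part.
      low≤ = subst (λ U → length (residue U (low i)) ≤ 3 * rest.K i + 2 * V) Uᵢ≡[] (rest.unused i Wᵢ≡[])
      regroup : ∀ k v t → (3 * k + 2 * v) + (3 * t + 2) ≡ 3 * (t + k) + 2 * suc v
      regroup = solve-∀

  -- Counting the entries over all blocks.

  module _ {V m P} {B : Fin P → List ℕ} (2V≤m : 2 * V ≤ m) (short : ∀ i → length (B i) ≤ m)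
           (packing : Packing V B) where
    open Packing packing

    block-inequality : ∀ i → length (B i) + 2 * V * length (W i) ≤ 3 * K i + 2 * V + m * length (W i)
    block-inequality i with W i | unused i
    ... | []    | unusedᵢ = begin
      length (B i) + 2 * V * 0      ≡⟨ cong (length (B i) +_) (*-zeroʳ (2 * V)) ⟩
      length (B i) + 0              ≤⟨ +-mono-≤ (unusedᵢ refl) z≤n ⟩
      3 * K i + 2 * V + m * 0       ∎
      where open ≤-Reasoning
    ... | _ ∷ w | _ = begin
      length (B i) + 2 * V * suc (length w)   ≤⟨ +-mono-≤ (short i) (≤-reflexive (*-suc (2 * V) (length w))) ⟩
      m + (2 * V + 2 * V * length w)          ≤⟨ +-monoʳ-≤ m (+-monoʳ-≤ (2 * V) (*-monoˡ-≤ (length w) 2V≤m)) ⟩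
      m + (2 * V + m * length w)              ≤⟨ m≤n+m _ (3 * K i) ⟩
      3 * K i + (m + (2 * V + m * length w))  ≡⟨ regroup (3 * K i) (2 * V) m (length w) ⟩
      3 * K i + 2 * V + m * suc (length w)    ∎
      where
      open ≤-Reasoning
      regroup : ∀ k v m w → k + (m + (v + m * w)) ≡ k + v + m * suc w
      regroup = solve-∀

    sum-inequality : ∀ n d {b w k : Fin n → ℕ} → (∀ i → b i + d * w i ≤ 3 * k i + d + m * w i) →
                     sum b + d * sum w ≤ 3 * sum k + d * n + m * sum w
    sum-inequality zero d le = ≤-trans (≤-reflexive (*-zeroʳ d)) z≤n
    sum-inequality (suc n) d {b} {w} {k} le = begin
      (b zero + sum (b ∘ suc)) + d * (w zero + sum (w ∘ suc))
        ≡⟨ regroupˡ (b zero) _ d (w zero) _ ⟩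
      (b zero + d * w zero) + (sum (b ∘ suc) + d * sum (w ∘ suc))
        ≤⟨ +-mono-≤ (le zero) (sum-inequality n d (le ∘ suc)) ⟩
      (3 * k zero + d + m * w zero) + (3 * sum (k ∘ suc) + d * n + m * sum (w ∘ suc))
        ≡⟨ regroupʳ (k zero) d m (w zero) _ n _ ⟩
      3 * (k zero + sum (k ∘ suc)) + d * suc n + m * (w zero + sum (w ∘ suc)) ∎
      where
      open ≤-Reasoning
      regroupˡ : ∀ b b′ d w w′ → (b + b′) + d * (w + w′) ≡ (b + d * w) + (b′ + d * w′)
      regroupˡ = solve-∀
      regroupʳ : ∀ k d m w k′ n w′ → (3 * k + d + m * w) + (3 * k′ + d * n + m * w′) ≡
                                     3 * (k + k′) + d * suc n + m * (w + w′)
      regroupʳ = solve-∀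

    -- The block inequalities are added up, and `yield` exchanges the triples for pairs at rate `c`.
    total-inequality : length (join B) + 2 * V * length (join W) ≤
                       c * length (join W) + 2 * V * P + m * length (join W)
    total-inequality = begin
      length (join B) + 2 * V * length (join W)
        ≡⟨ cong₂ (λ b w → b + 2 * V * w) (length-join B) (length-join W) ⟩
      sum (length ∘ B) + 2 * V * sum (length ∘ W)
        ≤⟨ sum-inequality P (2 * V) block-inequality ⟩
      3 * sum K + 2 * V * P + m * sum (length ∘ W)
        ≤⟨ +-monoˡ-≤ _ (+-monoˡ-≤ _ yield) ⟩
      c * length (join W) + 2 * V * P + m * sum (length ∘ W)
        ≡⟨ cong (λ w → c * length (join W) + 2 * V * P + m * w) (length-join W) ⟨
      c * length (join W) + 2 * V * P + m * length (join W) ∎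
      where open ≤-Reasoning

-- Cutting a list into blocks of bounded length.

chop : ∀ n → ℕ → List A → Fin n → List A
chop _ m xs zero    = take m xs
chop _ m xs (suc i) = chop _ m (drop m xs) i

join-chop : ∀ n m (xs : List A) → length xs ≤ n * m → join (chop n m xs) ≡ xs
join-chop zero    m []  _ = refl
join-chop (suc n) m xs le = trans (cong (take m xs ++_) (join-chop n m (drop m xs) drop≤)) (take++drop≡id m xs)
  where
  drop≤ : length (drop m xs) ≤ n * m
  drop≤ = subst (_≤ n * m) (sym (length-drop m xs)) (m≤n+o⇒m∸n≤o (length xs) m le)

length-chop : ∀ n m (xs : List A) i → length (chop n m xs i) ≤ m
length-chop (suc n) m xs zero    = ≤-trans (≤-reflexive (length-take m xs)) (m⊓n≤m m _)
length-chop (suc n) m xs (suc i) = length-chop n m (drop m xs) i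

-- Numerical estimates.

^-distribʳ-* : ∀ k m n → (m * n) ^ k ≡ m ^ k * n ^ k
^-distribʳ-* zero    m n = refl
^-distribʳ-* (suc k) m n = trans (cong (m * n *_) (^-distribʳ-* k m n)) (interchange m n (m ^ k) (n ^ k))

5th-root : ∀ n → ∃[ q ] q ^ 5 ≤ n × n < suc q ^ 5
5th-root zero = 0 , z≤n , s≤s z≤n
5th-root (suc n) with q , q⁵≤n , n<[1+q]⁵ ← 5th-root n with suc n <? suc q ^ 5
... | yes 1+n< = q , m≤n⇒m≤1+n q⁵≤n , 1+n<
... | no  1+n≮ = suc q , ≮⇒≥ 1+n≮ , ≤-<-trans n<[1+q]⁵ (^-monoˡ-< 5 (n<1+n (suc q)))

-- For `q >= 12` the ratio `(1 + q) / q` is at most 13/12, and the fifth power of 13/12 is below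
-- 3/2. The inequality already fails at `q = 11`.
1+q⁵-bound : ∀ {q} → 12 ≤ q → 2 * suc q ^ 5 ≤ 3 * q ^ 5
1+q⁵-bound {q} 12≤q = *-cancelˡ-≤ (12 ^ 5) (begin
  12 ^ 5 * (2 * suc q ^ 5)   ≡⟨ x∙yz≈y∙xz (12 ^ 5) 2 (suc q ^ 5) ⟩
  2 * (12 ^ 5 * suc q ^ 5)   ≡⟨ cong (2 *_) (^-distribʳ-* 5 12 (suc q)) ⟨
  2 * (12 * suc q) ^ 5       ≤⟨ *-monoʳ-≤ 2 (^-monoˡ-≤ 5 12[1+q]≤13q) ⟩
  2 * (13 * q) ^ 5           ≡⟨ cong (2 *_) (^-distribʳ-* 5 13 q) ⟩
  2 * (13 ^ 5 * q ^ 5)       ≡⟨ *-assoc 2 (13 ^ 5) (q ^ 5) ⟨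
  2 * 13 ^ 5 * q ^ 5         ≤⟨ *-monoˡ-≤ (q ^ 5) (toWitness {a? = 2 * 13 ^ 5 ≤? 12 ^ 5 * 3} _) ⟩
  12 ^ 5 * 3 * q ^ 5         ≡⟨ *-assoc (12 ^ 5) 3 (q ^ 5) ⟩
  12 ^ 5 * (3 * q ^ 5)       ∎)
  where
  open ≤-Reasoning
  12[1+q]≤13q : 12 * suc q ≤ 13 * q
  12[1+q]≤13q = begin
    12 * suc q   ≡⟨ *-suc 12 q ⟩
    12 + 12 * q  ≤⟨ +-monoˡ-≤ (12 * q) 12≤q ⟩
    13 * q       ∎

-- Weighted AM–GM: n^(3/5) lies below its tangent at b.
am-gm : ∀ {b n} → b ≤ n → 3125 * b ^ 2 * n ^ 3 ≤ (2 * b + 3 * n) ^ 5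
am-gm {b} {n} b≤n = begin
  3125 * b ^ 2 * n ^ 3                ≡⟨ cong (λ n → 3125 * b ^ 2 * n ^ 3) (m+[n∸m]≡n b≤n) ⟨
  3125 * b ^ 2 * (b + d) ^ 3          ≤⟨ m≤m+n _ _ ⟩
  3125 * b ^ 2 * (b + d) ^ 3 + excess ≡⟨ expand b d ⟨
  (2 * b + 3 * (b + d)) ^ 5           ≡⟨ cong (λ n → (2 * b + 3 * n) ^ 5) (m+[n∸m]≡n b≤n) ⟩
  (2 * b + 3 * n) ^ 5                 ∎
  where
  open ≤-Reasoning
  d = n ∸ b
  -- Both sides agree to first order at `n = b`, so the difference is `d * d` times a polynomial,
  -- here with positive coefficients.
  excess = d * d * (1875 * (b * b * b) + 3625 * (b * b * d) + 2025 * (b * d * d) + 243 * (d * d * d))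
  expand : ∀ b d → (let x = 2 * b + 3 * (b + d) in x * (x * (x * (x * (x * 1))))) ≡
    3125 * (b * (b * 1)) * ((b + d) * ((b + d) * ((b + d) * 1))) +
    d * d * (1875 * (b * b * b) + 3625 * (b * b * d) + 2025 * (b * d * d) + 243 * (d * d * d))
  expand = solve-∀

-- The tangent at `b = q ^ 5` has no roots left, as `b^(2/5)` is `q ^ 2`. It gives
-- `5 q^2 n^(3/5) <= 2 q^5 + 3 n`, and `8 * L` lies below `n^(3/5)` by assumption.
linearise : ∀ {n q L} → q ^ 5 ≤ n → (8 * L) ^ 5 < n ^ 3 → 40 * (q * q * L) ≤ 2 * q ^ 5 + 3 * n
linearise {n} {q} {L} q⁵≤n short = ≮⇒≥ λ big → <⇒≱ (^-monoˡ-< 5 big) (begin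
  (40 * (q * q * L)) ^ 5               ≡⟨ expand q L ⟩
  3125 * (q ^ 5) ^ 2 * (8 * L) ^ 5     ≤⟨ *-monoʳ-≤ (3125 * (q ^ 5) ^ 2) (<⇒≤ short) ⟩
  3125 * (q ^ 5) ^ 2 * n ^ 3           ≤⟨ am-gm q⁵≤n ⟩
  (2 * q ^ 5 + 3 * n) ^ 5              ∎)
  where
  open ≤-Reasoning
  regroup : ∀ q L → 40 * (q * q * L) ≡ 5 * (q * (q * 1)) * (8 * L)
  regroup = solve-∀
  expand : ∀ q L → (40 * (q * q * L)) ^ 5 ≡ 3125 * (q ^ 5) ^ 2 * (8 * L) ^ 5
  expand q L = begin-equality
    (40 * (q * q * L)) ^ 5             ≡⟨ cong (_^ 5) (regroup q L) ⟩
    (5 * q ^ 2 * (8 * L)) ^ 5          ≡⟨ ^-distribʳ-* 5 (5 * q ^ 2) (8 * L) ⟩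
    (5 * q ^ 2) ^ 5 * (8 * L) ^ 5      ≡⟨ cong (_* (8 * L) ^ 5) (^-distribʳ-* 5 5 (q ^ 2)) ⟩
    3125 * (q ^ 2) ^ 5 * (8 * L) ^ 5   ≡⟨ cong (λ x → 3125 * x * (8 * L) ^ 5) (trans (^-*-assoc q 2 5) (sym (^-*-assoc q 5 2))) ⟩
    3125 * (q ^ 5) ^ 2 * (8 * L) ^ 5   ∎

-- Used with s = q² and b = q⁵.
balance : ∀ {s b n} → 144 ≤ s → 12 * (s * s) ≤ b → b ≤ n →
          15 * s * (2 * b + 3 * n) + 40 * (1 + s) * (n + 3 * s) < 120 * s * n
balance {s} {b} {n} 144≤s 12s²≤b b≤n = begin-strict
  15 * s * (2 * b + 3 * n) + 40 * (1 + s) * (n + 3 * s)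
    ≤⟨ +-monoˡ-≤ _ (*-monoʳ-≤ (15 * s) (+-monoˡ-≤ (3 * n) (*-monoʳ-≤ 2 b≤n))) ⟩
  15 * s * (2 * n + 3 * n) + 40 * (1 + s) * (n + 3 * s)
    ≡⟨ collect s n ⟩
  -- The main terms take 115 of the 120 multiples of `s * n`; the remaining 5 absorb the lower-order
  -- terms, at most `60 * n`, because `s > 12`.
  115 * (s * n) + 5 * (8 * n + 24 * (s + s * s))
    ≤⟨ +-monoʳ-≤ (115 * (s * n)) (*-monoʳ-≤ 5 (+-monoʳ-≤ (8 * n) lower-order)) ⟩
  115 * (s * n) + 5 * (8 * n + 4 * n)
    ≡⟨ cong (λ x → 115 * (s * n) + 5 * x) (*-distribʳ-+ n 8 4) ⟨
  115 * (s * n) + 5 * (12 * n)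
    <⟨ +-monoʳ-< (115 * (s * n)) (*-monoʳ-< 5 (*-monoˡ-< n 12<s)) ⟩
  115 * (s * n) + 5 * (s * n)
    ≡⟨ total s n ⟩
  120 * s * n ∎
  where
  open ≤-Reasoning
  12<s : 12 < s
  12<s = ≤-trans (toWitness {a? = 13 ≤? 144} _) 144≤s
  instance
    s≢0 : NonZero s
    s≢0 = >-nonZero (≤-<-trans z≤n 12<s)
    n≢0 : NonZero n
    n≢0 = >-nonZero (<-≤-trans (>-nonZero⁻¹ (12 * (s * s)) ⦃ m*n≢0 12 (s * s) ⦃ _ ⦄ ⦃ m*n≢0 s s ⦄ ⦄) (≤-trans 12s²≤b b≤n))
  lower-order : 24 * (s + s * s) ≤ 4 * n
  lower-order = begin
    24 * (s + s * s)       ≤⟨ *-monoʳ-≤ 24 (+-monoˡ-≤ (s * s) (m≤m*n s s)) ⟩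
    24 * (s * s + s * s)   ≡⟨ quarter (s * s) ⟩
    4 * (12 * (s * s))     ≤⟨ *-monoʳ-≤ 4 (≤-trans 12s²≤b b≤n) ⟩
    4 * n                  ∎
    where
    quarter : ∀ x → 24 * (x + x) ≡ 4 * (12 * x)
    quarter = solve-∀
  collect : ∀ s n → 15 * s * (2 * n + 3 * n) + 40 * (1 + s) * (n + 3 * s) ≡
                    115 * (s * n) + 5 * (8 * n + 24 * (s + s * s))
  collect = solve-∀
  total : ∀ s n → 115 * (s * n) + 5 * (s * n) ≡ 120 * s * n
  total = solve-∀

-- If `L` were too small, then to leading order `n <= 5 s L + s P` with `5 s L` at most `5n/8` and
-- `s P` at most `n/3`; but 5/8 + 1/3 = 23/24 < 1. The factor `120 * s` clears the denominators.
large-bound : ∀ {n q V P L} → 12 ≤ q → q ^ 5 ≤ n → q * q ≤ 2 * V → 2 * V ≤ 1 + q * q →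
              P * (3 * (q * q)) ≤ n + 3 * (q * q) →
              n + 2 * V * L ≤ 3 * (q * q) * L + 2 * V * P + 3 * (q * q) * L →
              n ^ 3 ≤ (8 * L) ^ 5
large-bound {n} {q} {V} {P} {L} 12≤q q⁵≤n V≥ V≤ P≤ count = ≮⇒≥ λ short → <-irrefl refl (begin-strict
  120 * s * n
    ≤⟨ *-monoʳ-≤ (120 * s) n≤ ⟩
  120 * s * (5 * (s * L) + (1 + s) * P)
    ≡⟨ regroup s L P ⟩
  15 * s * (40 * (s * L)) + 40 * (1 + s) * (P * (3 * s))
    ≤⟨ +-mono-≤ (*-monoʳ-≤ (15 * s) (linearise {q = q} {L = L} q⁵≤n short)) (*-monoʳ-≤ (40 * (1 + s)) P≤) ⟩
  15 * s * (2 * q ^ 5 + 3 * n) + 40 * (1 + s) * (n + 3 * s)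
    <⟨ balance (*-mono-≤ 12≤q 12≤q) 12s²≤q⁵ q⁵≤n ⟩
  120 * s * n ∎)
  where
  open ≤-Reasoning
  s = q * q
  regroup : ∀ s L P → 120 * s * (5 * (s * L) + (1 + s) * P) ≡ 15 * s * (40 * (s * L)) + 40 * (1 + s) * (P * (3 * s))
  regroup = solve-∀
  12s²≤q⁵ : 12 * (s * s) ≤ q ^ 5
  12s²≤q⁵ = ≤-trans (*-monoˡ-≤ (s * s) 12≤q) (≤-reflexive (power q))
    where
    power : ∀ q → q * (q * q * (q * q)) ≡ q * (q * (q * (q * (q * 1))))
    power = solve-∀
  collect : ∀ s L vp → 3 * s * L + vp + 3 * s * L ≡ (5 * (s * L) + vp) + s * L
  collect = solve-∀
  n≤ : n ≤ 5 * (s * L) + (1 + s) * P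
  -- The term `2 * V * L` recovered from the used blocks cancels one of the six multiples of
  -- `s * L`, leaving five.
  n≤ = +-cancelʳ-≤ (s * L) _ _ (begin
    n + s * L                               ≤⟨ +-monoʳ-≤ n (*-monoˡ-≤ L V≥) ⟩
    n + 2 * V * L                           ≤⟨ count ⟩
    3 * s * L + 2 * V * P + 3 * s * L       ≡⟨ collect s L (2 * V * P) ⟩
    5 * (s * L) + 2 * V * P + s * L         ≤⟨ +-monoˡ-≤ (s * L) (+-monoʳ-≤ (5 * (s * L)) (*-monoˡ-≤ P V≤)) ⟩
    5 * (s * L) + (1 + s) * P + s * L       ∎)

-- Up to `L = 250` the sixth power of `1 + 2 * L` is compared with the fifth power of `8 * L` by
-- computation. Beyond that `8 * L` exceeds `12 ^ 3`, and `n <= 12 ^ 5` suffices.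
small-bound : ∀ {n L} → 2 ≤ n → n ≤ 12 ^ 5 → n ≤ (1 + 2 * L) ^ 2 → n ^ 3 ≤ (8 * L) ^ 5
small-bound {L = zero} 2≤n _ n≤1 = contradiction (≤-trans 2≤n n≤1) λ { (s≤s ()) }
small-bound {n} {suc l} _ n≤12⁵ n≤ with l <? 250
... | yes l<250 = begin
  n ^ 3                           ≤⟨ ^-monoˡ-≤ 3 n≤ ⟩
  ((1 + 2 * suc l) ^ 2) ^ 3       ≡⟨ ^-*-assoc (1 + 2 * suc l) 2 3 ⟩
  (1 + 2 * suc l) ^ 6             ≤⟨ table l<250 ⟩
  (8 * suc l) ^ 5                 ∎
  where
  open ≤-Reasoning
  table : ∀ {l} → l < 250 → (1 + 2 * suc l) ^ 6 ≤ (8 * suc l) ^ 5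
  table = toWitness {a? = allUpTo? (λ l → (1 + 2 * suc l) ^ 6 ≤? (8 * suc l) ^ 5) 250} _
... | no l≮250 = begin
  n ^ 3              ≤⟨ ^-monoˡ-≤ 3 n≤12⁵ ⟩
  (12 ^ 5) ^ 3       ≤⟨ toWitness {a? = (12 ^ 5) ^ 3 ≤? (8 * 250) ^ 5} _ ⟩
  (8 * 250) ^ 5      ≤⟨ ^-monoˡ-≤ 5 (*-monoʳ-≤ 8 (m≤n⇒m≤1+n (≮⇒≥ l≮250))) ⟩
  (8 * suc l) ^ 5    ∎
  where open ≤-Reasoning

-- Rounding and the choice of parameters.

s≤2⌈s/2⌉ : ∀ s → s ≤ 2 * ⌈ s /2⌉
s≤2⌈s/2⌉ s = begin
  s                       ≡⟨ ⌊n/2⌋+⌈n/2⌉≡n s ⟨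
  ⌊ s /2⌋ + ⌈ s /2⌉       ≤⟨ +-mono-≤ (⌊n/2⌋≤⌈n/2⌉ s) (m≤m+n _ 0) ⟩
  2 * ⌈ s /2⌉             ∎
  where open ≤-Reasoning

2⌈s/2⌉≤1+s : ∀ s → 2 * ⌈ s /2⌉ ≤ 1 + s
2⌈s/2⌉≤1+s s = begin
  2 * ⌈ s /2⌉                  ≡⟨ cong (⌈ s /2⌉ +_) (+-identityʳ _) ⟩
  ⌊ suc s /2⌋ + ⌊ suc s /2⌋    ≤⟨ +-monoʳ-≤ ⌈ s /2⌉ (⌊n/2⌋≤⌈n/2⌉ (suc s)) ⟩
  ⌊ suc s /2⌋ + ⌈ suc s /2⌉    ≡⟨ ⌊n/2⌋+⌈n/2⌉≡n (suc s) ⟩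
  1 + s                        ∎
  where open ≤-Reasoning

-- If l > q, the number of values in a band is the better of the two bounds on 3k.
cube-gain : ∀ q {k l} → k ≤ l ^ 3 → 3 * k ≤ 3 * q ^ 3 → 3 * k ≤ 3 * (q * q) * l
cube-gain q {k} {l} k≤l³ 3k≤3q³ with ≤-total l q
... | inj₁ l≤q = begin
  3 * k              ≤⟨ *-monoʳ-≤ 3 k≤l³ ⟩
  3 * l ^ 3          ≡⟨ regroup l ⟩
  3 * (l * l) * l    ≤⟨ *-monoˡ-≤ l (*-monoʳ-≤ 3 (*-mono-≤ l≤q l≤q)) ⟩
  3 * (q * q) * l    ∎
  where
  open ≤-Reasoning
  regroup : ∀ l → 3 * (l * (l * (l * 1))) ≡ 3 * (l * l) * l
  regroup = solve-∀
... | inj₂ q≤l = begin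
  3 * k              ≤⟨ 3k≤3q³ ⟩
  3 * q ^ 3          ≡⟨ regroup q ⟩
  3 * (q * q) * q    ≤⟨ *-monoʳ-≤ (3 * (q * q)) q≤l ⟩
  3 * (q * q) * l    ∎
  where
  open ≤-Reasoning
  regroup : ∀ l → 3 * (l * (l * (l * 1))) ≡ 3 * (l * l) * l
  regroup = solve-∀

-- The bands span at least `(3/2) q^5` values, which is at least `(1 + q)^5`. Strictness matters:
-- they start at 0, while the value `n` must still be covered.
values-fit : ∀ {n q} → 12 ≤ q → n < suc q ^ 5 → n < ⌈ q * q /2⌉ * (3 * q ^ 3)
values-fit {n} {q} 12≤q n< = *-cancelˡ-< 2 _ _ (begin-strict
  2 * n                                    <⟨ *-monoʳ-< 2 n< ⟩
  2 * suc q ^ 5                            ≤⟨ 1+q⁵-bound 12≤q ⟩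
  3 * q ^ 5                                ≡⟨ regroup q ⟩
  q * q * (3 * q ^ 3)                      ≤⟨ *-monoˡ-≤ (3 * q ^ 3) (s≤2⌈s/2⌉ (q * q)) ⟩
  2 * ⌈ q * q /2⌉ * (3 * q ^ 3)            ≡⟨ *-assoc 2 ⌈ q * q /2⌉ (3 * q ^ 3) ⟩
  2 * (⌈ q * q /2⌉ * (3 * q ^ 3))          ∎)
  where
  open ≤-Reasoning
  regroup : ∀ q → 3 * (q * (q * (q * (q * (q * 1))))) ≡ q * q * (3 * (q * (q * (q * 1))))
  regroup = solve-∀

n≤[1+n/m]*m : ∀ n m .{{_ : NonZero m}} → n ≤ suc (n / m) * m
n≤[1+n/m]*m n m = begin
  n                       ≡⟨ m≡m%n+[m/n]*n n m ⟩
  n % m + n / m * m       ≤⟨ +-monoˡ-≤ (n / m * m) (<⇒≤ (m%n<n n m)) ⟩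
  suc (n / m) * m         ∎
  where open ≤-Reasoning

-- Pairs from a monotone subsequence, for small `n`.

pairUp : List ℕ → List Pair
pairUp (x ∷ y ∷ xs) = (x , y) ∷ pairUp xs
pairUp _            = []

flat-pairUp : ∀ xs → flat (pairUp xs) ⊆ xs
flat-pairUp (x ∷ y ∷ xs) = refl ∷ refl ∷ flat-pairUp xs
flat-pairUp []           = []
flat-pairUp (x ∷ [])     = minimum _

length-pairUp : ∀ xs → length xs ≤ 1 + 2 * length (pairUp xs)
length-pairUp (x ∷ y ∷ xs) =
  subst (λ k → 2 + length xs ≤ 1 + k) (sym (*-suc 2 (length (pairUp xs)))) (s≤s (s≤s (length-pairUp xs)))
length-pairUp []           = z≤n
length-pairUp (x ∷ [])     = ≤-refl

AllPairs-pairUp : ∀ {R : Rel ℕ 0ℓ} {xs} → AllPairs R xs →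
                  AllPairs (λ (x , y) (x′ , y′) → R x x′ × R y y′) (pairUp xs)
AllPairs-pairUp []       = []
AllPairs-pairUp (_ ∷ []) = []
AllPairs-pairUp {xs = _ ∷ _ ∷ xs} ((_ ∷ x) ∷ y ∷ rs) =
  All.zipWith (λ ((p , _) , (_ , q)) → p , q) (halves x , halves y) ∷ AllPairs-pairUp rs
  where
  halves : ∀ {P} → All P xs → All (λ (x , y) → P x × P y) (pairUp xs)
  halves ps = All-flat (pairUp xs) (All-resp-⊆ (flat-pairUp xs) ps)

≢⇒<⊎> : ∀ {m n} → m ≢ n → m < n ⊎ m > n
≢⇒<⊎> {m} {n} m≢n with <-cmp m n
... | tri< m<n _ _ = inj₁ m<n
... | tri≈ _ m≡n _ = contradiction m≡n m≢n
... | tri> _ _ m>n = inj₂ m>n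

≤-square : ∀ {k m n o} → m ≤ n * o → n ≤ k → o ≤ k → m ≤ k ^ 2
≤-square m≤no n≤k o≤k = ≤-trans m≤no (*-mono-≤ n≤k (≤-trans o≤k (≤-reflexive (sym (*-identityʳ _)))))

-- Erdős-Szekeres, as Mirsky's theorem for `<` and `>`. Consecutive pairs of a monotone sequence are
-- compatible; the 1 allows for an unpaired last entry.
monotone-pairs : ∀ {a} → Unique a → ∃[ W ] flat W ⊆ a × AllPairs Same W × length a ≤ (1 + 2 * length W) ^ 2
monotone-pairs {a} u
  with C , D , τ , inc , σ , dec , bound ← mirsky {S = _>_} _<?_ <-trans (AllPairs.map ≢⇒<⊎> u)
  with ≤-total (length D) (length C)
... | inj₁ d≤c = pairUp C , ⊆-trans (flat-pairUp C) τ , AllPairs.map inj₁ (AllPairs-pairUp inc) ,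
                 ≤-square bound (length-pairUp C) (≤-trans d≤c (length-pairUp C))
... | inj₂ c≤d = pairUp D , ⊆-trans (flat-pairUp D) σ , AllPairs.map inj₂ (AllPairs-pairUp dec) ,
                 ≤-square bound (≤-trans c≤d (length-pairUp D)) (length-pairUp D)

-- Assembling the two cases.

permutation-length : ∀ {n a} → IsPermutationOf [1⋯ n ] a → length a ≡ n
permutation-length {n} {a} (u , a⇔[1⋯n]) = ≤-antisym
  (Unique-interval-length 1 n u (All.tabulate λ x∈a → let 1≤x , x≤n = to (a⇔[1⋯n] _) x∈a in 1≤x , s≤s x≤n))
  (subst (_≤ length a) (length-applyUpTo suc n)
    (Unique⇒length≤ (Unique.applyUpTo⁺₁ suc n (λ i<j _ → <⇒≢ (s<s i<j))) in-a))
  where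
  open Equivalence
  in-a : ∀ {x} → x ∈ applyUpTo suc n → x ∈ a
  in-a x∈ with i , i<n , refl ← ∈-applyUpTo⁻ suc x∈ = from (a⇔[1⋯n] _) (s≤s z≤n , i<n)

block-pairs : ∀ {n a q} → 12 ≤ q → q ^ 5 ≤ n → n < suc q ^ 5 → IsPermutationOf [1⋯ n ] a →
              ∃[ W ] flat W ⊆ a × AllPairs Same W × n ^ 3 ≤ (8 * length W) ^ 5
block-pairs {n} {a} {q} 12≤q q⁵≤n n<[1+q]⁵ perm@(u , a⇔[1⋯n]) =
  join W , ⊆-trans (⊆-reflexive (concatMap-join _ W)) (⊆-trans (join-⊆ flat-⊆) (⊆-reflexive join-B)) , same ,
  large-bound {V = V} {P = P} 12≤q q⁵≤n (s≤2⌈s/2⌉ s) (2⌈s/2⌉≤1+s s) P-bound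
    (subst (λ l → l + 2 * V * length (join W) ≤ m * length (join W) + 2 * V * P + m * length (join W)) |B|
    (total-inequality 2V≤m (length-chop P m a) packing))
  where
  instance
    q≢0 : NonZero q
    q≢0 = >-nonZero (≤-trans (s≤s z≤n) 12≤q)
    q²≢0 : NonZero (q * q)
    q²≢0 = m*n≢0 q q
    m≢0 : NonZero (3 * (q * q))
    m≢0 = m*n≢0 3 (q * q)
  s m h V P : ℕ
  s = q * q
  -- `m` is both the block length and the rate `c`: a pair costs at most `m` for the block it uses
  -- and `m` for triples. With this `h`, the two bounds in `cube-gain` meet at `l = q`.
  m = 3 * s
  h = 3 * q ^ 3
  V = ⌈ s /2⌉
  P = suc (n / m)

  open Bands h m (cube-gain q)

  B : Fin P → List ℕ
  B = chop P m a

  join-B : join B ≡ a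
  join-B = join-chop P m a (≤-trans (≤-reflexive (permutation-length perm)) (n≤[1+n/m]*m n m))

  |B| : length (join B) ≡ n
  |B| = trans (cong length join-B) (permutation-length perm)

  bounded : All (_< V * h) (join B)
  bounded = subst (All (_< V * h)) (sym join-B)
    (All.tabulate λ x∈a → ≤-<-trans (proj₂ (Equivalence.to (a⇔[1⋯n] _) x∈a)) (values-fit 12≤q n<[1+q]⁵))

  packing : Packing V B
  packing = pack V B (subst Unique (sym join-B) u) (All.tabulate⁻ (All.concat⁻ bounded))
  open Packing packing

  2V≤m : 2 * V ≤ m
  2V≤m = begin
    2 * V    ≤⟨ 2⌈s/2⌉≤1+s s ⟩
    1 + s    ≤⟨ +-monoˡ-≤ s (>-nonZero⁻¹ s) ⟩
    s + s    ≤⟨ +-monoʳ-≤ s (m≤m+n s _) ⟩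
    3 * s    ∎
    where open ≤-Reasoning

  P-bound : P * m ≤ n + m
  P-bound = ≤-trans (+-monoʳ-≤ m (m/n*n≤m n m)) (≤-reflexive (+-comm m n))

many-pairs : ∀ {n a} → 2 ≤ n → IsPermutationOf [1⋯ n ] a →
             ∃[ W ] flat W ⊆ a × AllPairs Same W × n ^ 3 ≤ (8 * length W) ^ 5
many-pairs {n} 2≤n perm@(unique , _)
  with q , q⁵≤n , n<[1+q]⁵ ← 5th-root n
  with q <? 12
... | no  q≮12 = block-pairs (≮⇒≥ q≮12) q⁵≤n n<[1+q]⁵ perm
... | yes q<12 with W , τ , same , a≤ ← monotone-pairs unique =
  W , τ , same , small-bound {L = length W} 2≤n (≤-trans (<⇒≤ n<[1+q]⁵) (^-monoˡ-≤ 5 q<12))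
    (subst (_≤ (1 + 2 * length W) ^ 2) (permutation-length perm) a≤)

-- Fifth powers express `L >= n^(3/5) / 8` within the natural numbers.
theorem1 : ∀ (n : ℕ) → 2 ≤ n → ∀ (a : List ℕ) → IsPermutationOf [1⋯ n ] a →
    ∃[ L ] Σ[ u ∈ Vec ℕ L ] Σ[ v ∈ Vec ℕ L ] Twins a u v × n ^ 3 ≤ (8 * L) ^ 5
theorem1 n 2≤n a perm@(unique , _) with W , τ , same , bound ← many-pairs 2≤n perm =
  -, -, -, pairs⇒twins unique W τ same , bound
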